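{- Let $B$ be a barrier on an infinite set $X\subseteq\mathbb{N}$. For every function $f:B\to\mathbb{N}$ there exists a barrier $B'\subseteq B$ such that for all $s\in B'$, if $f(s)\in b(B')$ then $f(s)\in s$ (where $b(B')=\bigcup B'$ is the base of $B'$).
   Context: $\mathbb{N}$ is the set of natural numbers (including $0$). Subsets of $\mathbb{N}$ are identified with their strictly increasing enumerations; $s\sqsubset Y$ means that $s$ is a proper initial segment of $Y$ as a sequence; $\subset$ is strict set inclusion. A set $B$ of finite subsets of $\mathbb{N}$ is a barrier on an infinite set $X\subseteq\mathbb{N}$ if: (1) $\bigcup B=X$; (2) for all $s,t\in B$, $s\not\subset t$; (3) for every infinite $Y\subseteq X$ there is $s\in B$ with $s\sqsubset Y$. The set $b(B)=\bigcup B$ is called the base of $B$. A family $B'$ is called a barrier if it is a barrier on its base $b(B')$ (in particular $b(B')$ is infinite). -}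

module Defs where

open import Data.List.Base using (List; applyUpTo)
open import Data.List.Membership.Propositional using () renaming (_∈_ to _∈ˡ_)
open import Data.List.Relation.Unary.Linked using (Linked)
open import Data.Nat.Base using (ℕ; _<_)
open import Data.Nat.InfinitelyOften using (Inf)
open import Data.Product.Base using (∃-syntax; _×_)
open import Level using (0ℓ; suc)
open import Relation.Binary.Core using (_Preserves_⟶_)
open import Relation.Binary.PropositionalEquality.Core using (_≡_)
open import Relation.Nullary.Negation.Core using (¬_)
open import Relation.Unary using (Pred; _∈_; _⊆_; _⊂_; _≐_)

-- A finite subset of ℕ is its strictly increasing enumeration.  The field
-- `increasing` is irrelevant, so sets with the same list are equal.
record FinSet : Set where
  constructor mkFinSet
  field
    elements    : List ℕ
    .increasing : Linked _<_ elements

open FinSet public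

⟦_⟧ : FinSet → Pred ℕ 0ℓ
⟦ s ⟧ x = x ∈ˡ elements s

-- Only infinite sets have such an enumeration.
record Enumerates (e : ℕ → ℕ) (Y : Pred ℕ 0ℓ) : Set where
  field
    increasing : e Preserves _<_ ⟶ _<_
    sound      : ∀ i → e i ∈ Y
    complete   : ∀ {y} → y ∈ Y → ∃[ i ] e i ≡ y

infix 4 _⊏_

-- s is an initial segment of the infinite set Y, as sequences; it is
-- automatically proper, since s is finite.
_⊏_ : FinSet → Pred ℕ 0ℓ → Set
s ⊏ Y = ∃[ e ] Enumerates e Y × ∃[ n ] elements s ≡ applyUpTo e n

base : Pred FinSet 0ℓ → Pred ℕ 0ℓ
base B x = ∃[ s ] s ∈ B × x ∈ ⟦ s ⟧

-- `Inf X` says that X is not bounded above.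
record IsBarrierOn (B : Pred FinSet 0ℓ) (X : Pred ℕ 0ℓ) : Set (suc 0ℓ) where
  field
    infinite  : Inf X
    union     : base B ≐ X
    antichain : ∀ {s t} → s ∈ B → t ∈ B → ¬ (⟦ s ⟧ ⊂ ⟦ t ⟧)
    bar       : (Y : Pred ℕ 0ℓ) → Inf Y → Y ⊆ X → ∃[ s ] s ∈ B × s ⊏ Y

IsBarrier : Pred FinSet 0ℓ → Set (suc 0ℓ)
IsBarrier B = IsBarrierOn B (base B)

{-# OPTIONS --safe #-}

-- Extensions of a finite set s to members of B form a well-founded tree, so one
-- can induct on it (bar induction).  For each s, every bound N and every
-- infinite U one finds an infinite V ⊆ U such that the value v of f at each
-- member s ∪ t of B with t ⊆ V satisfies v ∈ V → v ∈ t, and min(v, N) does not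
-- depend on t.  At a node, a fusion of the sets obtained for the children s ∪ {n}
-- with bound n gives a set on which this can only fail for values v < n, which
-- depend on n alone: v = c(n).  Colouring n by the parity of the length of the
-- descent n > c(n) > c(c(n)) > … and passing to one colour removes these values.
-- At the root this yields an infinite V, and the restriction of B to V is the
-- required barrier.
module Submission where

open import Axiom.DoubleNegationElimination using (em⇒dne)
open import Axiom.ExcludedMiddle using (ExcludedMiddle)
open import Data.Bool.Base using (Bool; true; false; not)
open import Data.Bool.Properties using (not-¬)
open import Data.List.Base using (List; []; _∷_; _++_; applyUpTo)
open import Data.List.Membership.Propositional using () renaming (_∈_ to _∈ˡ_)
open import Data.List.Membership.Propositional.Properties
  using (∈-applyUpTo⁻; ∈-++⁺ˡ; ∈-++⁺ʳ)
open import Data.List.Properties using (++-identityʳ)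
open import Data.List.Relation.Unary.All as All using (All; []; _∷_)
open import Data.List.Relation.Unary.AllPairs using (AllPairs; []; _∷_)
open import Data.List.Relation.Unary.Any using (here; there)
open import Data.List.Relation.Unary.Linked using (linked?)
open import Data.List.Relation.Unary.Linked.Properties using (Linked⇒AllPairs)
open import Data.Nat.Base using (ℕ; zero; suc; _≤_; _<_; _⊓_; _⊔_; z≤n; z<s; s<s)
open import Data.Nat.Induction using (<-rec)
open import Data.Nat.InfinitelyOften using (Inf; commutes-with-∪; witness)
  renaming (map to Inf-map)
open import Data.Nat.Properties
open import Data.Product.Base using (Σ-syntax; ∃-syntax; _×_; _,_; proj₁; proj₂)
open import Data.Sum.Base using (_⊎_; inj₁; inj₂)
open import Function.Base using (_∘_; id)
open import Level using (0ℓ)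
open import Relation.Binary.Core using (_Preserves_⟶_)
open import Relation.Binary.Definitions using (tri<; tri≈; tri>)
open import Relation.Binary.PropositionalEquality
  using (_≡_; refl; sym; trans; cong; cong₂; subst; module ≡-Reasoning)
open import Relation.Nullary using (¬_; yes; no; contradiction)
open import Relation.Nullary.Decidable using (recompute)
open import Relation.Unary using (Pred; _∈_; _⊆_; _⊂_; _∩_; _∪_)
open import Defs

private
  Increasing : List ℕ → Set
  Increasing = AllPairs _<_

  Range : (ℕ → ℕ) → Pred ℕ 0ℓ
  Range e x = ∃[ i ] e i ≡ x

  Inf-∩≥ : ∀ {U : Pred ℕ 0ℓ} i → Inf U → Inf (U ∩ (i ≤_))
  Inf-∩≥ i inf (j , none) = inf (i ⊔ j , λ k le u →
    none k (≤-trans (m≤n⊔m i j) le) (u , ≤-trans (m≤m⊔n i j) le))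

-- Strictly increasing enumerations

increasing-id≤ : ∀ {e} → e Preserves _<_ ⟶ _<_ → ∀ i → i ≤ e i
increasing-id≤ mono zero    = z≤n
increasing-id≤ mono (suc i) = ≤-<-trans (increasing-id≤ mono i) (mono (n<1+n i))

increasing-cancel-< : ∀ {e} → e Preserves _<_ ⟶ _<_ → ∀ {i j} → e i < e j → i < j
increasing-cancel-< {e} mono {i} {j} lt with <-cmp i j
... | tri< i<j _ _  = i<j
... | tri≈ _ refl _ = contradiction lt (<-irrefl refl)
... | tri> _ _ j<i  = contradiction (mono j<i) (<-asym lt)

increasing-mono-≤ : ∀ {e} → e Preserves _<_ ⟶ _<_ → ∀ {i j} → i ≤ j → e i ≤ e j
increasing-mono-≤ mono le with m≤n⇒m<n∨m≡n le
... | inj₁ lt   = <⇒≤ (mono lt)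
... | inj₂ refl = ≤-refl

Range-inf : ∀ {e} → e Preserves _<_ ⟶ _<_ → Inf (Range e)
Range-inf {e} mono (i , none) = none (e i) (increasing-id≤ mono i) (i , refl)

-- `d i` is the entry of `e` at `index i`, and `index` is itself increasing, so `i ≤ index i`.
Range-⊆⇒≤ : ∀ {d e} → d Preserves _<_ ⟶ _<_ → e Preserves _<_ ⟶ _<_ →
  Range d ⊆ Range e → ∀ i → e i ≤ d i
Range-⊆⇒≤ {d} {e} d-mono e-mono sub i =
  ≤-trans (increasing-mono-≤ e-mono (increasing-id≤ index-mono i))
          (≤-reflexive (index-eq i))
  where
  index : ℕ → ℕ
  index k = proj₁ (sub (k , refl))

  index-eq : ∀ k → e (index k) ≡ d k
  index-eq k = proj₂ (sub (k , refl))

  index-mono : index Preserves _<_ ⟶ _<_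
  index-mono {j} {k} lt = increasing-cancel-< e-mono
    (subst (_< e (index k)) (sym (index-eq j))
      (subst (d j <_) (sym (index-eq k)) (d-mono lt)))

-- Needed because `_⊏_` only provides some enumeration of a set, which must be identified with a
-- given one.
Enumerates-Range : ∀ {d e} → e Preserves _<_ ⟶ _<_ → Enumerates d (Range e) →
  ∀ i → d i ≡ e i
Enumerates-Range {d} {e} e-mono enum i = ≤-antisym
  (Range-⊆⇒≤ e-mono d-mono (complete enum) i)
  (Range-⊆⇒≤ d-mono e-mono (λ { (j , refl) → sound enum j }) i)
  where
  open Enumerates
  d-mono : d Preserves _<_ ⟶ _<_
  d-mono = Enumerates.increasing enum

applyUpTo-cong : ∀ {d e : ℕ → ℕ} → (∀ i → d i ≡ e i) → ∀ n →
  applyUpTo d n ≡ applyUpTo e n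
applyUpTo-cong eq zero    = refl
applyUpTo-cong eq (suc n) = cong₂ _∷_ (eq 0) (applyUpTo-cong (eq ∘ suc) n)

-- Diagonals of decreasing sequences of sets

module Diagonal {a} {S : Set a} (carrier : S → Pred ℕ 0ℓ)
  (pick : S → ℕ) (next : S → S)
  (pick∈ : ∀ s → pick s ∈ carrier s)
  (next⊆ : ∀ s → carrier (next s) ⊆ carrier s ∩ (pick s <_)) where

  -- Recursion advances the state, so the tail of `diagonal s` is `diagonal (next s)` by definition.
  diagonal : S → ℕ → ℕ
  diagonal s zero    = pick s
  diagonal s (suc i) = diagonal (next s) i

  diagonal∈ : ∀ s i → diagonal s i ∈ carrier s
  diagonal∈ s zero    = pick∈ s
  diagonal∈ s (suc i) = proj₁ (next⊆ s (diagonal∈ (next s) i))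

  diagonal-mono : ∀ s → diagonal s Preserves _<_ ⟶ _<_
  diagonal-mono s {zero}  {suc j} _        = proj₂ (next⊆ s (diagonal∈ (next s) j))
  diagonal-mono s {suc i} {suc j} (s<s lt) = diagonal-mono (next s) lt

-- Parity of the length of the descent n > c n > c (c n) > …

data Parity (c : ℕ → ℕ) : ℕ → Bool → Set where
  stop    : ∀ {n} → n ≤ c n → Parity c n false
  descend : ∀ {n b} → c n < n → Parity c (c n) b → Parity c n (not b)

parity-total : ∀ c n → ∃[ b ] Parity c n b
parity-total c = <-rec (λ n → ∃[ b ] Parity c n b) step
  where
  step : ∀ n → (∀ {m} → m < n → ∃[ b ] Parity c m b) → ∃[ b ] Parity c n b
  step n rec with <-≤-connex (c n) n
  ... | inj₂ n≤cn = false , stop n≤cn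
  ... | inj₁ cn<n = let b , p = rec cn<n in not b , descend cn<n p

parity-unique : ∀ {c n a b} → Parity c n a → Parity c n b → a ≡ b
parity-unique (stop _)      (stop _)      = refl
parity-unique (stop le)     (descend lt _) = contradiction lt (≤⇒≯ le)
parity-unique (descend lt _) (stop le)     = contradiction lt (≤⇒≯ le)
parity-unique (descend _ p) (descend _ q) = cong not (parity-unique p q)

-- Thinning and fusion of infinite sets

module _ (em : ExcludedMiddle 0ℓ) where

  Inf-∪ : ∀ {P Q : Pred ℕ 0ℓ} → Inf (P ∪ Q) → Inf P ⊎ Inf Q
  Inf-∪ inf = em⇒dne em (commutes-with-∪ inf)

  Inf-element : ∀ {P : Pred ℕ 0ℓ} → Inf P → ∃[ x ] x ∈ P
  Inf-element inf = em⇒dne em (witness inf)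

  -- One step of the descent flips the parity, so `n` and a smaller `c n` never share a class; one
  -- of the two classes is infinite.
  avoid-descent : ∀ (c : ℕ → ℕ) {U : Pred ℕ 0ℓ} → Inf U →
    Σ[ V ∈ Pred ℕ 0ℓ ] Inf V × V ⊆ U × (∀ {n} → n ∈ V → c n < n → ¬ c n ∈ V)
  avoid-descent c {U} inf =
    let b , class-inf = Inf-class in class b , class-inf , proj₁ , avoids
    where
    class : Bool → Pred ℕ 0ℓ
    class b = U ∩ λ n → Parity c n b

    split : U ⊆ class false ∪ class true
    split {n} u with parity-total c n
    ... | false , p = inj₁ (u , p)
    ... | true  , p = inj₂ (u , p)

    avoids : ∀ {b n} → n ∈ class b → c n < n → ¬ c n ∈ class b
    avoids (_ , p) lt (_ , q) = not-¬ refl (parity-unique p (descend lt q))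

    Inf-class : ∃[ b ] Inf (class b)
    Inf-class with Inf-∪ (Inf-map split inf)
    ... | inj₁ i = false , i
    ... | inj₂ i = true , i

  -- Only finitely many truncated values exist. Passing from `N` to `suc N` changes the truncation
  -- only where `N < c n`, and there it equals `suc N`.
  truncation-constant : ∀ (c : ℕ → ℕ) N {U : Pred ℕ 0ℓ} → Inf U →
    Σ[ V ∈ Pred ℕ 0ℓ ] Inf V × V ⊆ U × (∃[ a ] (∀ {n} → n ∈ V → c n ⊓ N ≡ a))
  truncation-constant c zero    {U} inf = U , inf , id , 0 , λ {n} _ → ⊓-zeroʳ (c n)
  truncation-constant c (suc N) {U} inf
    with V , V-inf , V⊆U , a , const ← truncation-constant c N inf
    with Inf-∪ {V ∩ λ n → N < c n} {V ∩ λ n → c n ≤ N} (Inf-map split V-inf)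
    where
    split : ∀ {n} → n ∈ V → n ∈ (V ∩ λ n → N < c n) ∪ (V ∩ λ n → c n ≤ N)
    split {n} n∈V with <-≤-connex N (c n)
    ... | inj₁ N<c = inj₁ (n∈V , N<c)
    ... | inj₂ c≤N = inj₂ (n∈V , c≤N)
  ... | inj₁ big   = _ , big , V⊆U ∘ proj₁ , suc N , m≥n⇒m⊓n≡n ∘ proj₂
  ... | inj₂ small = _ , small , V⊆U ∘ proj₁ , a , λ (n∈V , c≤N) →
    trans (m≤n⇒m⊓n≡m (m≤n⇒m≤1+n c≤N)) (trans (sym (m≤n⇒m⊓n≡m c≤N)) (const n∈V))

  -- After each pick `n` the reservoir is shrunk to a set with `P n`. All later picks stay in it,
  -- and heredity passes `P n` on to them.
  fusion : ∀ {W : Pred ℕ 0ℓ} (P : ℕ → Pred ℕ 0ℓ → Set) →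
    (∀ {n U V} → V ⊆ U → P n U → P n V) →
    (∀ {n U} → n ∈ W → U ⊆ W → U ⊆ (n <_) → Inf U →
      Σ[ V ∈ Pred ℕ 0ℓ ] Inf V × V ⊆ U × P n V) →
    Inf W →
    Σ[ V ∈ Pred ℕ 0ℓ ] Inf V × V ⊆ W × (∀ {n} → n ∈ V → P n (V ∩ (n <_)))
  fusion {W} P hereditary shrink W-inf =
    Range (diagonal start) , Range-inf (diagonal-mono start) ,
    (λ { (i , refl) → proj₂ (proj₂ start) (diagonal∈ start i) }) ,
    (λ { (i , refl) → let _ , sub , p = tail start i in
                      hereditary (λ (x∈ , lt) → sub x∈ lt) p })
    where
    Reservoir : Set₁
    Reservoir = Σ[ U ∈ Pred ℕ 0ℓ ] Inf U × U ⊆ W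

    pick : Reservoir → ℕ
    pick (_ , inf , _) = proj₁ (Inf-element inf)

    pick∈ : ∀ s → pick s ∈ proj₁ s
    pick∈ (_ , inf , _) = proj₂ (Inf-element inf)

    shrunk : ∀ s → Σ[ V ∈ Pred ℕ 0ℓ ] Inf V × V ⊆ proj₁ s ∩ (pick s <_) × P (pick s) V
    shrunk s@(U , inf , U⊆W) =
      shrink (U⊆W (pick∈ s)) (U⊆W ∘ proj₁) proj₂ (Inf-∩≥ (suc (pick s)) inf)

    next : Reservoir → Reservoir
    next s@(_ , _ , U⊆W) = let V , V-inf , V⊆ , _ = shrunk s in
      V , V-inf , U⊆W ∘ proj₁ ∘ V⊆

    open Diagonal proj₁ pick next pick∈ (λ s → proj₁ (proj₂ (proj₂ (shrunk s))))

    start : Reservoir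
    start = W , W-inf , id

    -- The witness is the reservoir left after the pick at index `i`.
    tail : ∀ s i → Σ[ V ∈ Pred ℕ 0ℓ ]
      (∀ {x} → x ∈ Range (diagonal s) → diagonal s i < x → x ∈ V) × P (diagonal s i) V
    tail s zero = _ , later , proj₂ (proj₂ (proj₂ (shrunk s)))
      where
      later : ∀ {x} → x ∈ Range (diagonal s) → pick s < x → x ∈ proj₁ (shrunk s)
      later (zero  , refl) lt = contradiction lt (<-irrefl refl)
      later (suc j , refl) lt = diagonal∈ (next s) j
    tail s (suc i) = let V , sub , p = tail (next s) i in V , later sub , p
      where
      later : ∀ {V : Pred ℕ 0ℓ} →
        (∀ {x} → x ∈ Range (diagonal (next s)) → diagonal (next s) i < x → x ∈ V) →
        ∀ {x} → x ∈ Range (diagonal s) → diagonal (next s) i < x → x ∈ V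
      later sub (zero  , refl) lt =
        contradiction (diagonal-mono s {0} {suc i} z<s) (<-asym lt)
      later sub (suc j , refl) lt = sub (j , refl) lt

-- A relation F t v stands for a partial function on finite sequences:
-- t belongs to its domain and has value v.
Family : Set₁
Family = List ℕ → ℕ → Set

-- For `t = []` this is single-valuedness. In general, a value at `s` fixes the values at all
-- extensions, so a leaf carries a single value.
Consistent : Family → Set
Consistent F = ∀ s {t u v} → F s u → F (s ++ t) v → v ≡ u

Free : Family → Pred ℕ 0ℓ → Set
Free F V = ∀ {t v} → F t v → Increasing t → All V t → v ∈ V → v ∈ˡ t

-- The truncation determines `v` exactly when `v < N`, and otherwise tells only that `N ≤ v`.
TruncatesTo : Family → ℕ → ℕ → Pred ℕ 0ℓ → Set
TruncatesTo F N a V = ∀ {t v} → F t v → Increasing t → All V t → v ⊓ N ≡ a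

Homogeneous : Family → ℕ → Pred ℕ 0ℓ → Set
Homogeneous F N V = Free F V × ∃[ a ] TruncatesTo F N a V

Homogeneous-⊆ : ∀ {F N U V} → V ⊆ U → Homogeneous F N U → Homogeneous F N V
Homogeneous-⊆ V⊆U (free , a , trunc) =
  (λ Ft inc all v∈V → free Ft inc (All.map V⊆U all) (V⊆U v∈V)) ,
  a , (λ Ft inc all → trunc Ft inc (All.map V⊆U all))

-- The well-founded tree of sequences above which the domain is reached; children keep only larger
-- numbers, so branches are increasing.
data Barred (X : Pred ℕ 0ℓ) (F : Family) : Set where
  leaf : ∀ {v} → F [] v → Barred X F
  node : (∀ {v} → ¬ F [] v) →
         (∀ n → n ∈ X → Barred (X ∩ (n <_)) (F ∘ (n ∷_))) → Barred X F

-- Homogeneous sets and bar induction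

module _ (em : ExcludedMiddle 0ℓ) where

  homogeneous-subset : ∀ {X F} → Barred X F → Consistent F →
    ∀ N {U : Pred ℕ 0ℓ} → Inf U → U ⊆ X →
    Σ[ V ∈ Pred ℕ 0ℓ ] Inf V × V ⊆ U × Homogeneous F N V
  homogeneous-subset (leaf {w} Fw) con N {U} U-inf U⊆X =
    -- The only value is `w`; discarding all numbers up to `w` makes freeness vacuous.
    U ∩ (suc w ≤_) , Inf-∩≥ (suc w) U-inf , proj₁ ,
    (λ { Ft _ _ (_ , w<v) → contradiction (con [] Fw Ft) (>⇒≢ w<v) }) ,
    w ⊓ N , (λ Ft _ _ → cong (_⊓ N) (con [] Fw Ft))
  homogeneous-subset {X} {F} (node ¬F[] children) con N {U} U-inf U⊆X =
    V₃ , V₃-inf , proj₁ ∘ V₁⊆ ∘ V₂⊆ ∘ V₃⊆ , free , a , trunc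
    where
    fused : Σ[ V ∈ Pred ℕ 0ℓ ] Inf V × V ⊆ U ∩ (N ≤_) ×
      (∀ {n} → n ∈ V → Homogeneous (F ∘ (n ∷_)) n (V ∩ (n <_)))
    fused = fusion em (λ n → Homogeneous (F ∘ (n ∷_)) n) Homogeneous-⊆
      (λ {n} n∈W S⊆W S⊆>n S-inf →
        homogeneous-subset (children n (U⊆X (proj₁ n∈W))) (λ s → con (n ∷ s)) n
          S-inf (λ x∈S → U⊆X (proj₁ (S⊆W x∈S)) , S⊆>n x∈S))
      -- With `N ≤ n` for every first element `n`, the truncation at `n` determines the one at `N`.
      (Inf-∩≥ N U-inf)

    V₁ : Pred ℕ 0ℓ
    V₁ = proj₁ fused

    V₁⊆ : V₁ ⊆ U ∩ (N ≤_)
    V₁⊆ = proj₁ (proj₂ (proj₂ fused))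

    below : ∀ {n} → n ∈ V₁ → Homogeneous (F ∘ (n ∷_)) n (V₁ ∩ (n <_))
    below = proj₂ (proj₂ (proj₂ fused))

    -- The default 0 outside `V₁` makes `c` total, so that every descent is defined; the truncation
    -- property is only claimed on `V₁`.
    value : ∀ n → ∃[ b ] (n ∈ V₁ → TruncatesTo (F ∘ (n ∷_)) n b (V₁ ∩ (n <_)))
    value n with em {n ∈ V₁}
    ... | yes n∈V₁ = let b , t = proj₂ (below n∈V₁) in b , λ _ → t
    ... | no  n∉V₁ = 0 , λ n∈V₁ → contradiction n∈V₁ n∉V₁

    c : ℕ → ℕ
    c n = proj₁ (value n)

    avoiding : Σ[ V ∈ Pred ℕ 0ℓ ] Inf V × V ⊆ V₁ × (∀ {n} → n ∈ V → c n < n → ¬ c n ∈ V)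
    avoiding = avoid-descent em c (proj₁ (proj₂ fused))

    V₂ : Pred ℕ 0ℓ
    V₂ = proj₁ avoiding

    V₂⊆ : V₂ ⊆ V₁
    V₂⊆ = proj₁ (proj₂ (proj₂ avoiding))

    constant : Σ[ V ∈ Pred ℕ 0ℓ ] Inf V × V ⊆ V₂ × (∃[ a ] (∀ {n} → n ∈ V → c n ⊓ N ≡ a))
    constant = truncation-constant em c N (proj₁ (proj₂ avoiding))

    V₃ : Pred ℕ 0ℓ
    V₃ = proj₁ constant

    V₃-inf : Inf V₃
    V₃-inf = proj₁ (proj₂ constant)

    V₃⊆ : V₃ ⊆ V₂
    V₃⊆ = proj₁ (proj₂ (proj₂ constant))

    a : ℕ
    a = proj₁ (proj₂ (proj₂ (proj₂ constant)))

    above : ∀ {n t} → All (n <_) t → All V₃ t → All (V₁ ∩ (n <_)) t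
    above n<t all = All.zipWith (λ (n<x , x∈V₃) → V₂⊆ (V₃⊆ x∈V₃) , n<x) (n<t , all)

    value-below : ∀ {n t v} → F (n ∷ t) v → Increasing (n ∷ t) → All V₃ (n ∷ t) →
      v ⊓ n ≡ c n
    value-below {n} Ft (n<t ∷ inc) (n∈V₃ ∷ all) =
      proj₂ (value n) (V₂⊆ (V₃⊆ n∈V₃)) Ft inc (above n<t all)

    free : Free F V₃
    free {[]}         Ft = contradiction Ft ¬F[]
    free {n ∷ t} {v} Ft incs@(n<t ∷ inc) alls@(n∈V₃ ∷ all) v∈V₃ with <-cmp v n
    -- Here `v` survives truncation at `n`, so it is `c n`, which `V₂` was chosen to avoid.
    ... | tri< v<n _ _  = contradiction (subst V₂ v≡cn (V₃⊆ v∈V₃))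
          (proj₂ (proj₂ (proj₂ avoiding)) (V₃⊆ n∈V₃) (subst (_< n) v≡cn v<n))
      where
      v≡cn : v ≡ c n
      v≡cn = trans (sym (m≤n⇒m⊓n≡m (<⇒≤ v<n))) (value-below Ft incs alls)
    ... | tri≈ _ v≡n _ = here v≡n
    ... | tri> _ _ n<v = there (proj₁ (below (V₂⊆ (V₃⊆ n∈V₃))) Ft inc (above n<t all)
                                 (V₂⊆ (V₃⊆ v∈V₃) , n<v))

    trunc : TruncatesTo F N a V₃
    trunc {[]}         Ft = contradiction Ft ¬F[]
    trunc {n ∷ t} {v} Ft inc all@(n∈V₃ ∷ _) = begin
      v ⊓ N        ≡⟨ cong (v ⊓_) (m≥n⇒m⊓n≡n (proj₂ (V₁⊆ (V₂⊆ (V₃⊆ n∈V₃))))) ⟨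
      v ⊓ (n ⊓ N)  ≡⟨ ⊓-assoc v n N ⟨
      (v ⊓ n) ⊓ N  ≡⟨ cong (_⊓ N) (value-below Ft inc all) ⟩
      c n ⊓ N      ≡⟨ proj₂ (proj₂ (proj₂ (proj₂ constant))) n∈V₃ ⟩
      a            ∎
      where open ≡-Reasoning

  -- An unbarred node has an unbarred child. Following such children gives an increasing sequence in
  -- `X` with no initial segment in the domain.
  bar-induction : ∀ {X F} →
    (∀ e → e Preserves _<_ ⟶ _<_ → Range e ⊆ X → ∃[ n ] ∃[ v ] F (applyUpTo e n) v) →
    Barred X F
  bar-induction {X} {F} hits = em⇒dne em λ ¬barred →
    let start = X , F , ¬barred
        n , _ , Fn = hits (diagonal start) (diagonal-mono start)
                       (λ { (i , refl) → diagonal∈ start i })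
    in avoids start n Fn
    where
    Unbarred : Set₁
    Unbarred = Σ[ X ∈ Pred ℕ 0ℓ ] Σ[ F ∈ Family ] ¬ Barred X F

    unbarred-child : (s : Unbarred) → let X , F , _ = s in
      ∃[ n ] n ∈ X × ¬ Barred (X ∩ (n <_)) (F ∘ (n ∷_))
    unbarred-child (X , F , ¬barred) = em⇒dne em λ none →
      ¬barred (node (λ F[] → ¬barred (leaf F[]))
        (λ n n∈X → em⇒dne em λ ¬child → none (n , n∈X , ¬child)))

    pick : Unbarred → ℕ
    pick s = proj₁ (unbarred-child s)

    next : Unbarred → Unbarred
    next s@(X , F , _) =
      X ∩ (pick s <_) , F ∘ (pick s ∷_) , proj₂ (proj₂ (unbarred-child s))

    open Diagonal proj₁ pick next (λ s → proj₁ (proj₂ (unbarred-child s))) (λ s → id)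

    avoids : ∀ s n {v} → ¬ proj₁ (proj₂ s) (applyUpTo (diagonal s) n) v
    avoids (_ , _ , ¬barred) zero    Fv = ¬barred (leaf Fv)
    avoids s                 (suc n) Fv = avoids (next s) n Fv

-- Barriers

FinSet-increasing : ∀ s → Increasing (elements s)
FinSet-increasing (mkFinSet l inc) =
  Linked⇒AllPairs <-trans (recompute (linked? _<?_ l) inc)

prefix∌next : ∀ s {x t} → Increasing (s ++ x ∷ t) → ¬ x ∈ˡ s
prefix∌next (y ∷ s) (y< ∷ _)  (here refl) =
  <-irrefl refl (All.lookup y< (∈-++⁺ʳ s (here refl)))
prefix∌next (y ∷ s) (_ ∷ inc) (there x∈s) = prefix∌next s inc x∈s

proper-prefix⇒⊂ : ∀ {s s′ x t} → elements s′ ≡ elements s ++ x ∷ t → ⟦ s ⟧ ⊂ ⟦ s′ ⟧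
proper-prefix⇒⊂ {s} {s′} {x} eq =
  (λ y∈s → subst (_ ∈ˡ_) (sym eq) (∈-++⁺ˡ y∈s)) ,
  (λ s′⊆s → prefix∌next (elements s) (subst Increasing eq (FinSet-increasing s′))
              (s′⊆s (subst (x ∈ˡ_) (sym eq) (∈-++⁺ʳ (elements s) (here refl)))))

⊏⇒⊆ : ∀ {s Y} → s ⊏ Y → ⟦ s ⟧ ⊆ Y
⊏⇒⊆ (e , enum , n , eq) {x} x∈s
  with i , _ , refl ← ∈-applyUpTo⁻ e (subst (x ∈ˡ_) eq x∈s) = Enumerates.sound enum i

graph : (B : Pred FinSet 0ℓ) → ((s : FinSet) → .(s ∈ B) → ℕ) → Family
graph B f t v = Σ[ s ∈ FinSet ] Σ[ s∈B ∈ s ∈ B ] elements s ≡ t × f s s∈B ≡ v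

restrict : Pred FinSet 0ℓ → Pred ℕ 0ℓ → Pred FinSet 0ℓ
restrict B V s = s ∈ B × ⟦ s ⟧ ⊆ V

module _ {X : Pred ℕ 0ℓ} {B : Pred FinSet 0ℓ} (barrier : IsBarrierOn B X) where
  open IsBarrierOn barrier

  -- Equal lists give equal members of `B`, and `f` ignores the membership proof; a proper extension
  -- would violate the antichain condition.
  graph-consistent : ∀ f → Consistent (graph B f)
  graph-consistent f _ {[]} {u} {v} (s , s∈B , refl , refl) (s′ , s′∈B , eq , refl) =
    same s s′ s∈B s′∈B (trans eq (++-identityʳ _))
    where
    same : ∀ s s′ (p : s ∈ B) (p′ : s′ ∈ B) → elements s′ ≡ elements s → f s′ p′ ≡ f s p
    same (mkFinSet _ _) (mkFinSet _ _) p p′ refl = refl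
  graph-consistent f _ {x ∷ t} (s , s∈B , refl , _) (s′ , s′∈B , eq , _) =
    contradiction (proper-prefix⇒⊂ {s} {s′} eq) (antichain s∈B s′∈B)

  graph-barred : ExcludedMiddle 0ℓ → ∀ f → Barred X (graph B f)
  graph-barred em f = bar-induction em λ e mono e⊆X →
    let s , s∈B , d , enum , n , eq = bar (Range e) (Range-inf mono) e⊆X
    in n , f s s∈B , s , s∈B ,
       trans eq (applyUpTo-cong (Enumerates-Range mono enum) n) , refl

  -- The empty set would be strictly included in any member containing a point of `X`.
  nonempty : ExcludedMiddle 0ℓ → ∀ s → s ∈ B → ∃[ x ] x ∈ ⟦ s ⟧
  nonempty em (mkFinSet (x ∷ _) _) _ = x , here refl
  nonempty em s@(mkFinSet [] _) s∈B =
    let x , x∈X = Inf-element em infinite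
        t , t∈B , x∈t = proj₂ union x∈X
    in contradiction ((λ ()) , λ t⊆[] → contradiction (t⊆[] x∈t) λ ()) (antichain s∈B t∈B)

  restrict-barrier : ExcludedMiddle 0ℓ → ∀ {V} → Inf V → V ⊆ X → IsBarrier (restrict B V)
  restrict-barrier em {V} V-inf V⊆X = record
    -- The base may be smaller than `V`, so an element beyond `i` comes from a nonempty member
    -- inside the part of `V` from `i` on.
    { infinite  = λ (i , none) →
        let s , s∈B , s⊏ = bar (V ∩ (i ≤_)) (Inf-∩≥ i V-inf) (V⊆X ∘ proj₁)
            x , x∈s = nonempty em s s∈B
        in none x (proj₂ (⊏⇒⊆ {s} s⊏ x∈s)) (s , (s∈B , λ y∈s → proj₁ (⊏⇒⊆ {s} s⊏ y∈s)) , x∈s)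
    ; union     = id , id
    ; antichain = λ (s∈B , _) (t∈B , _) → antichain s∈B t∈B
    ; bar       = λ Y Y-inf Y⊆ →
        let Y⊆V = λ {y} (y∈Y : y ∈ Y) → base⊆ (Y⊆ y∈Y)
            -- A member that is an initial segment of `Y` lies in `V`, hence in the restriction.
            s , s∈B , s⊏Y = bar Y Y-inf (V⊆X ∘ Y⊆V)
        in s , (s∈B , λ x∈s → Y⊆V (⊏⇒⊆ {s} s⊏Y x∈s)) , s⊏Y
    }
    where
    base⊆ : base (restrict B V) ⊆ V
    base⊆ (_ , (_ , s⊆V) , x∈s) = s⊆V x∈s

mainTheorem1 : ExcludedMiddle 0ℓ →
    (X : Pred ℕ 0ℓ) (B : Pred FinSet 0ℓ) → IsBarrierOn B X →
    (f : (s : FinSet) → .(s ∈ B) → ℕ) →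
    Σ[ B′ ∈ Pred FinSet 0ℓ ] Σ[ B′⊆B ∈ B′ ⊆ B ]
    (IsBarrier B′ ×
    (∀ s (s∈B′ : s ∈ B′) →
    f s (B′⊆B s∈B′) ∈ base B′ → f s (B′⊆B s∈B′) ∈ ⟦ s ⟧))
mainTheorem1 em X B barrier f
  with V , V-inf , V⊆X , free , _ ←
    homogeneous-subset em (graph-barred barrier em f) (graph-consistent barrier f)
      -- At the root only freeness matters, so the trivial bound 0 suffices.
      0 (IsBarrierOn.infinite barrier) id
  = restrict B V , proj₁ , restrict-barrier barrier em V-inf V⊆X ,
    λ { s (s∈B , s⊆V) (_ , (_ , t⊆V) , fs∈t) →
        free (s , s∈B , refl , refl) (FinSet-increasing s) (All.tabulate s⊆V) (t⊆V fs∈t) }
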